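{- Let $w_1,w_2,w_3$ be any odd positive integers, let $n\ge 0$ be an integer and let $y_1\in\mathbb{Z}_p$. Then \begin{align*} &\sum_{k+l+m=n}\binom{n}{k,l,m}E_{k,q^{w_2w_3}}(w_1y_1)T_{l,q^{w_1w_3}}(w_2-1)T_{m,q^{w_1w_2}}(w_3-1)\,w_1^{l+m}w_2^{k+m}w_3^{k+l}\\ =&\sum_{k+l+m=n}\binom{n}{k,l,m}E_{k,q^{w_1w_3}}(w_2y_1)T_{l,q^{w_1w_2}}(w_3-1)T_{m,q^{w_2w_3}}(w_1-1)\,w_2^{l+m}w_3^{k+m}w_1^{k+l}\\ =&\sum_{k+l+m=n}\binom{n}{k,l,m}E_{k,q^{w_1w_2}}(w_3y_1)T_{l,q^{w_2w_3}}(w_1-1)T_{m,q^{w_1w_3}}(w_2-1)\,w_3^{l+m}w_1^{k+m}w_2^{k+l}. \end{align*}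
   Context: Let $p$ be a fixed odd prime, $\mathbb{C}_p$ the completion of an algebraic closure of $\mathbb{Q}_p$ with absolute value normalized by $|p|_p=1/p$, and let $q\in\mathbb{C}_p$ be fixed with $|q-1|_p<p^{ -1/(p-1)}$. For $r\in\mathbb{C}_p$ with $|r-1|_p<p^{ -1/(p-1)}$ (in particular for $r=q^w$, $w$ a positive integer), the $r$-Euler polynomials $E_{n,r}(x)$ ($n\ge 0$) are the polynomials in $x$ defined by the generating function $$\frac{2}{re^{t}+1}e^{xt}=\sum_{n=0}^{\infty}E_{n,r}(x)\frac{t^n}{n!}.$$ For integers $k,N\ge 0$, the $r$-analogue of the alternating power sum is $T_{k,r}(N)=\sum_{i=0}^{N}(-1)^i i^k r^i$, with the convention $0^0=1$. Sums over $k+l+m=n$ run over all nonnegative integers $k,l,m$ with $k+l+m=n$, and $\binom{n}{k,l,m}=\frac{n!}{k!\,l!\,m!}$. -}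

module Defs where

open import Level using (Level; 0ℓ; _⊔_) renaming (suc to lsuc)
open import Data.Nat.Base as ℕ using (ℕ; zero; suc; _∸_; NonZero; _!)
open import Data.Nat.Divisibility as ∣ using (_∣_)
open import Data.Nat.Primality using (Prime; prime⇒nonTrivial)
import Data.Nat.Properties as ℕ
import Data.Nat.DivMod as ℕ
open import Data.Integer.Base using (+_)
open import Data.Rational.Base as ℚ using (ℚ; 0ℚ; 1ℚ)
import Data.Rational.Properties as ℚ
open import Data.Fin.Base using (toℕ)
open import Data.Vec.Base using (Vec; []; _∷_; map)
open import Data.Product.Base using (Σ; ∃; _×_; _,_; proj₁; proj₂)
open import Data.Sum.Base using (inj₁; inj₂)
open import Relation.Nullary using (¬_; Dec; contradiction)
open import Relation.Nullary.Decidable using (decidable-stable)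
open import Relation.Binary.PropositionalEquality.Core as ≡ using (_≡_)
open import Algebra.Bundles using (CommutativeRing; Semiring)
open import Algebra.Apartness.Bundles using (HeytingField)
open import Algebra.Morphism.Structures using (module RingMorphisms)

private variable
  c ℓ₁ ℓ₂ c′ ℓ₁′ ℓ₂′ : Level

Odd : ℕ → Set
Odd n = n ℕ.% 2 ≡ 1

-- A non-archimedean absolute value |·| with |K^×| ⊆ p^ℚ, written additively as
-- |x| = p^(- v x).  (ℂ_p has value group exactly p^ℚ, so no real numbers are
-- needed.)  `v` is only defined away from 0, where it is a rational number.
record Valuation (F : HeytingField c ℓ₁ ℓ₂) : Set (c ⊔ ℓ₁ ⊔ ℓ₂) where
  open HeytingField F
  field
    v       : ∀ x → x # 0# → ℚ
    v-cong  : ∀ {x y} → x ≈ y → ∀ hx hy → v x hx ≡ v y hy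
    v-*     : ∀ x y hx hy hxy → v (x * y) hxy ≡ v x hx ℚ.+ v y hy
    v-ultra : ∀ x y hx hy hxy → v x hx ℚ.⊓ v y hy ℚ.≤ v (x + y) hxy

  infix 4 ∣_∣≤p^-_ ∣_∣<p^-_

  -- |x| ≤ p^(-s) and |x| < p^(-s); both hold for x ≈ 0#.
  ∣_∣≤p^-_ : Carrier → ℚ → Set ℓ₂
  ∣ x ∣≤p^- s = ∀ (h : x # 0#) → s ℚ.≤ v x h

  ∣_∣<p^-_ : Carrier → ℚ → Set ℓ₂
  ∣ x ∣<p^- s = ∀ (h : x # 0#) → s ℚ.< v x h

  field
    -- |y - x| < |x| implies y # 0.  If # is the negation of ≈ this already
    -- follows from the laws above; for a general apartness it says that #
    -- is the apartness of the metric.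
    #-open  : ∀ x y (h : x # 0#) s → v x h ℚ.< s → ∣ y - x ∣≤p^- s → y # 0#

record ValuedField c ℓ₁ ℓ₂ : Set (lsuc (c ⊔ ℓ₁ ⊔ ℓ₂)) where
  field
    heytingField : HeytingField c ℓ₁ ℓ₂
    valuation    : Valuation heytingField

  open HeytingField heytingField public
  open Valuation valuation public

  commutativeRing : CommutativeRing c ℓ₁
  commutativeRing = record { isCommutativeRing = isCommutativeRing }

  open CommutativeRing commutativeRing public using (ring; semiring; rawRing)

record Embedding (A : ValuedField c ℓ₁ ℓ₂) (B : ValuedField c′ ℓ₁′ ℓ₂′)
       : Set (c ⊔ ℓ₁ ⊔ ℓ₂ ⊔ c′ ⊔ ℓ₁′ ⊔ ℓ₂′) where
  private
    module A = ValuedField A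
    module B = ValuedField B
  field
    to                 : A.Carrier → B.Carrier
    isRingHomomorphism : RingMorphisms.IsRingHomomorphism A.rawRing B.rawRing to
    v-to               : ∀ x h h′ → B.v (to x) h′ ≡ A.v x h

  open RingMorphisms.IsRingHomomorphism isRingHomomorphism public

module _ (A : ValuedField c ℓ₁ ℓ₂) where
  open ValuedField A

  Cauchy : (ℕ → Carrier) → Set ℓ₂
  Cauchy a = ∀ s → ∃ λ N → ∀ m n → N ℕ.≤ m → N ℕ.≤ n → ∣ a m - a n ∣≤p^- s

  _⟶_ : (ℕ → Carrier) → Carrier → Set ℓ₂
  a ⟶ x = ∀ s → ∃ λ N → ∀ n → N ℕ.≤ n → ∣ a n - x ∣≤p^- s

  Complete : Set (c ⊔ ℓ₂)
  Complete = ∀ a → Cauchy a → ∃ λ x → a ⟶ x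

  -- monic (a₀ ∷ … ∷ aₙ₋₁ ∷ []) x = a₀ + a₁ x + … + aₙ₋₁ xⁿ⁻¹ + xⁿ
  monic : ∀ {n} → Vec Carrier n → Carrier → Carrier
  monic []       x = 1#
  monic (a ∷ as) x = a + x * monic as x

  AlgebraicallyClosed : Set (c ⊔ ℓ₁)
  AlgebraicallyClosed = ∀ n (as : Vec Carrier (suc n)) → ∃ λ x → monic as x ≈ 0#

module _ {A : ValuedField c ℓ₁ ℓ₂} {B : ValuedField c′ ℓ₁′ ℓ₂′} (i : Embedding A B) where
  private
    module A = ValuedField A
  open ValuedField B
  open Embedding i using (to)

  record IsCompletion : Set (c ⊔ c′ ⊔ ℓ₂′) where
    field
      complete : Complete B
      dense    : ∀ x s → ∃ λ a → ∣ x - to a ∣≤p^- s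

  record IsAlgebraicClosure : Set (c ⊔ c′ ⊔ ℓ₁′) where
    field
      algebraicallyClosed : AlgebraicallyClosed B
      algebraic           : ∀ x → ∃ λ n → Σ (Vec A.Carrier (suc n)) λ as →
                            monic B (map to as) x ≈ 0#

-- Together with multiplicativity: v (pᵏ a / b) = k for a, b prime to p.
record IsPAdic (p : ℕ) (val : Valuation ℚ.heytingField) : Set where
  open Valuation val
  field
    v-p    : ∀ h → v (+ p ℚ./ 1) h ≡ 1ℚ
    v-unit : ∀ n → ¬ p ∣ n → ∀ h → v (+ n ℚ./ 1) h ≡ 0ℚ

-- The tower ℚ ⊆ ℚ_p ⊆ (algebraic closure of ℚ_p) ⊆ ℂ_p, each step given by the
-- property that determines it up to isometric isomorphism.
record ℂₚ (p : ℕ) c ℓ₁ ℓ₂ : Set (lsuc (c ⊔ ℓ₁ ⊔ ℓ₂)) where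
  field
    p-adic  : Valuation ℚ.heytingField
    isPAdic : IsPAdic p p-adic

  ℚ-valued : ValuedField 0ℓ 0ℓ 0ℓ
  ℚ-valued = record { valuation = p-adic }

  field
    Qₚ    : ValuedField c ℓ₁ ℓ₂
    ℚ↪Qₚ  : Embedding ℚ-valued Qₚ
    Qₚ-isCompletion : IsCompletion ℚ↪Qₚ

    Q̄ₚ    : ValuedField c ℓ₁ ℓ₂
    Qₚ↪Q̄ₚ : Embedding Qₚ Q̄ₚ
    Q̄ₚ-isAlgebraicClosure : IsAlgebraicClosure Qₚ↪Q̄ₚ

    Cₚ    : ValuedField c ℓ₁ ℓ₂
    Q̄ₚ↪Cₚ : Embedding Q̄ₚ Cₚ
    Cₚ-isCompletion : IsCompletion Q̄ₚ↪Cₚ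

  fromQₚ : ValuedField.Carrier Qₚ → ValuedField.Carrier Cₚ
  fromQₚ x = Embedding.to Q̄ₚ↪Cₚ (Embedding.to Qₚ↪Q̄ₚ x)

  fromℚ : ℚ → ValuedField.Carrier Cₚ
  fromℚ x = fromQₚ (Embedding.to ℚ↪Qₚ x)

  -- ℤ_p = { x ∈ ℚ_p : |x| ≤ 1 }
  ℤₚ : Set (c ⊔ ℓ₂)
  ℤₚ = Σ (ValuedField.Carrier Qₚ) λ x → ValuedField.∣_∣≤p^-_ Qₚ x 0ℚ

  fromℤₚ : ℤₚ → ValuedField.Carrier Cₚ
  fromℤₚ (x , _) = fromQₚ x

multinomial : ℕ → ℕ → ℕ → ℕ → ℕ
multinomial n k l m = (n ! ℕ./ (k ! ℕ.* l ! ℕ.* m !)) {{nz}}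
  where
  nz : NonZero (k ! ℕ.* l ! ℕ.* m !)
  nz = ℕ.m*n≢0 (k ! ℕ.* l !) (m !) {{k ℕ.!* l !≢0}} {{m ℕ.!≢0}}

module ValuedFieldProperties (A : ValuedField c ℓ₁ ℓ₂) where
  open ValuedField A
  open import Algebra.Apartness.Properties.HeytingCommutativeRing
    (HeytingField.heytingCommutativeRing heytingField)
  open import Relation.Binary.Reasoning.Setoid setoid

  xy≈1⇒x#0 : ∀ {x y} → x * y ≈ 1# → x # 0#
  xy≈1⇒x#0 {x} {y} e = invertibleʳ⇒# (y , trans (*-congʳ (x-0≈x x)) e)

  x#0⇒inv : ∀ {x} → x # 0# → ∃ λ y → x * y ≈ 1#
  x#0⇒inv {x} h with #⇒invertible h
  ... | y , _ , e = y , trans (*-congʳ (sym (x-0≈x x))) e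

  xy#0⇒x#0 : ∀ {x y} → x * y # 0# → x # 0#
  xy#0⇒x#0 {x} {y} h with x#0⇒inv h
  ... | z , e = xy≈1⇒x#0 (trans (sym (*-assoc x y z)) e)

  v-1 : ∀ h → v 1# h ≡ 0ℚ
  v-1 h = ≡.trans (≡.sym (ℚ.+-identityʳ a))
      (≡.trans (≡.cong (a ℚ.+_) (≡.sym (ℚ.+-inverseʳ a)))
      (≡.trans (≡.sym (ℚ.+-assoc a a (ℚ.- a)))
      (≡.trans (≡.cong (ℚ._+ (ℚ.- a)) (≡.sym a≡a+a)) (ℚ.+-inverseʳ a))))
    where
    a = v 1# h
    a≡a+a : a ≡ a ℚ.+ a
    a≡a+a = ≡.trans (v-cong (sym (*-identityˡ 1#)) h h′) (v-* 1# 1# h h h′)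
      where h′ = #-congʳ (sym (*-identityˡ 1#)) h

  module _ (P : ℚ → Set) (P? : ∀ a → Dec (P a))
           (P-⊓ : ∀ {a b} → P a → P b → P (a ℚ.⊓ b))
           (P-≤ : ∀ {a b} → P a → a ℚ.≤ b → P b) where

    +-closed : ∀ x y → (∀ h → P (v x h)) → (∀ h → P (v y h)) → ∀ h → P (v (x + y) h)
    +-closed x y px py h = decidable-stable (P? _) λ ¬g →
      let
        ¬x#0 : ¬ x # 0#
        ¬x#0 hx =
          let
            ¬y#0 : ¬ y # 0#
            ¬y#0 hy = ¬g (P-≤ (P-⊓ (px hx) (py hy)) (v-ultra x y hx hy h))
            y≈0 = proj₁ (tight y 0#) ¬y#0
          in ¬g (≡.subst P (v-cong (sym (trans (+-congˡ y≈0) (+-identityʳ x))) hx h) (px hx))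
        x≈0 = proj₁ (tight x 0#) ¬x#0
        x+y≈y = trans (+-congʳ x≈0) (+-identityˡ y)
        hy = #-congʳ x+y≈y h
      in ¬g (≡.subst P (v-cong (sym x+y≈y) hy h) (py hy))

  ∣+∣< : ∀ {s} x y → ∣ x ∣<p^- s → ∣ y ∣<p^- s → ∣ x + y ∣<p^- s
  ∣+∣< {s} = +-closed (s ℚ.<_) (s ℚ.<?_) sel ℚ.<-≤-trans
    where
    sel : ∀ {a b} → s ℚ.< a → s ℚ.< b → s ℚ.< a ℚ.⊓ b
    sel {a} {b} p q with ℚ.⊓-sel a b
    ... | inj₁ e = ≡.subst (s ℚ.<_) (≡.sym e) p
    ... | inj₂ e = ≡.subst (s ℚ.<_) (≡.sym e) q

  ∣+∣≤ : ∀ {s} x y → ∣ x ∣≤p^- s → ∣ y ∣≤p^- s → ∣ x + y ∣≤p^- s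
  ∣+∣≤ {s} = +-closed (s ℚ.≤_) (s ℚ.≤?_) ℚ.⊓-glb ℚ.≤-trans

  ∣*∣< : ∀ {s} x y → ∣ x ∣≤p^- 0ℚ → ∣ y ∣<p^- s → ∣ x * y ∣<p^- s
  ∣*∣< {s} x y px py h = ≡.subst₂ ℚ._<_ (ℚ.+-identityˡ s) (≡.sym (v-* x y hx hy h))
                          (ℚ.+-mono-≤-< (px hx) (py hy))
    where
    hx = xy#0⇒x#0 h
    hy = xy#0⇒x#0 (#-congʳ (*-comm x y) h)

  ∣∣<-cong : ∀ {s x y} → x ≈ y → ∣ x ∣<p^- s → ∣ y ∣<p^- s
  ∣∣<-cong {s} e p h = ≡.subst (s ℚ.<_) (v-cong e h′ h) (p h′)
    where h′ = #-congʳ (sym e) h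

  ∣∣≤-cong : ∀ {s x y} → x ≈ y → ∣ x ∣≤p^- s → ∣ y ∣≤p^- s
  ∣∣≤-cong {s} e p h = ≡.subst (s ℚ.≤_) (v-cong e h′ h) (p h′)
    where h′ = #-congʳ (sym e) h

  x-1+1≈x : ∀ x → (x - 1#) + 1# ≈ x
  x-1+1≈x x = begin
    (x - 1#) + 1#     ≈⟨ +-assoc x (- 1#) 1# ⟩
    x + (- 1# + 1#)   ≈⟨ +-congˡ (-‿inverseˡ 1#) ⟩
    x + 0#            ≈⟨ +-identityʳ x ⟩
    x                 ∎

  -- If |x - 1| < 1 then |x| ≤ 1.
  integral : ∀ {s} x → 0ℚ ℚ.≤ s → ∣ x - 1# ∣<p^- s → ∣ x ∣≤p^- 0ℚ
  integral x 0≤s px = ∣∣≤-cong (x-1+1≈x x)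
    (∣+∣≤ (x - 1#) 1# (λ h → ℚ.≤-trans 0≤s (ℚ.<⇒≤ (px h)))
                      (λ h → ℚ.≤-reflexive (≡.sym (v-1 h))))

  xy-1 : ∀ x y → x * (y - 1#) + (x - 1#) ≈ x * y - 1#
  xy-1 x y = begin
    x * (y - 1#) + (x - 1#)            ≈⟨ +-congʳ (distribˡ x y (- 1#)) ⟩
    (x * y + x * - 1#) + (x - 1#)      ≈⟨ +-assoc _ _ _ ⟩
    x * y + (x * - 1# + (x - 1#))      ≈⟨ +-congˡ (+-assoc _ _ _) ⟨
    x * y + ((x * - 1# + x) - 1#)      ≈⟨ +-congˡ (+-congʳ e) ⟩
    x * y + (0# - 1#)                  ≈⟨ +-congˡ (+-identityˡ _) ⟩
    x * y - 1#                         ∎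
    where
    e : x * - 1# + x ≈ 0#
    e = begin
      x * - 1# + x        ≈⟨ +-congˡ (*-identityʳ x) ⟨
      x * - 1# + x * 1#   ≈⟨ distribˡ x (- 1#) 1# ⟨
      x * (- 1# + 1#)     ≈⟨ *-congˡ (-‿inverseˡ 1#) ⟩
      x * 0#              ≈⟨ zeroʳ x ⟩
      0#                  ∎

module EmbeddingProperties {A : ValuedField c ℓ₁ ℓ₂} {B : ValuedField c′ ℓ₁′ ℓ₂′}
                           (i : Embedding A B) where
  private
    module A = ValuedField A
    module B = ValuedField B
  open Embedding i

  to-# : ∀ {x} → x A.# A.0# → to x B.# B.0#
  to-# {x} h with ValuedFieldProperties.x#0⇒inv A h
  ... | y , e = ValuedFieldProperties.xy≈1⇒x#0 B
                  (B.trans (B.sym (*-homo x y)) (B.trans (⟦⟧-cong e) 1#-homo))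

module PowerSeries (A : ValuedField c ℓ₁ ℓ₂) where
  open ValuedField A
  open import Algebra.Definitions.RawSemiring (Semiring.rawSemiring semiring)
    using (sum)

  ∑≤ : ℕ → (ℕ → Carrier) → Carrier
  ∑≤ n f = sum {suc n} (λ i → f (toℕ i))

  Series : Set c
  Series = ℕ → Carrier

  const : Carrier → Series
  const a zero    = a
  const a (suc _) = 0#

  infixl 6 _⊞_
  infixl 7 _⊠_

  _⊞_ : Series → Series → Series
  (f ⊞ g) n = f n + g n

  _⊠_ : Series → Series → Series
  (f ⊠ g) n = ∑≤ n λ i → f i * g (n ∸ i)

  -- Long division f / g, for g with constant term apart from 0.
  divide : (f g : Series) → g 0 # 0# → Series
  divide f g h zero    = f 0 * proj₁ (ValuedFieldProperties.x#0⇒inv A h)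
  divide f g h (suc n) = divide (λ i → f (suc i) - divide f g h 0 * g (suc i)) g h n

  divide-⊠ : ∀ f g h n → (divide f g h ⊠ g) n ≈ f n
  divide-⊠ f g h zero = begin
    f 0 * d * g 0 + 0#   ≈⟨ +-identityʳ _ ⟩
    f 0 * d * g 0        ≈⟨ *-assoc _ _ _ ⟩
    f 0 * (d * g 0)      ≈⟨ *-congˡ (trans (*-comm _ _) (proj₂ (ValuedFieldProperties.x#0⇒inv A h))) ⟩
    f 0 * 1#             ≈⟨ *-identityʳ _ ⟩
    f 0                  ∎
    where
    open import Relation.Binary.Reasoning.Setoid setoid
    d = proj₁ (ValuedFieldProperties.x#0⇒inv A h)
  divide-⊠ f g h (suc n) = begin
    a + (divide f′ g h ⊠ g) n   ≈⟨ +-congˡ (divide-⊠ f′ g h n) ⟩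
    a + (f (suc n) - a)         ≈⟨ +-comm _ _ ⟩
    (f (suc n) - a) + a         ≈⟨ +-assoc _ _ _ ⟩
    f (suc n) + (- a + a)       ≈⟨ +-congˡ (-‿inverseˡ a) ⟩
    f (suc n) + 0#              ≈⟨ +-identityʳ _ ⟩
    f (suc n)                   ∎
    where
    open import Relation.Binary.Reasoning.Setoid setoid
    a  = divide f g h 0 * g (suc n)
    f′ = λ i → f (suc i) - divide f g h 0 * g (suc i)

module Euler (p : ℕ) (p-prime : Prime p) (p-odd : Odd p) (K : ℂₚ p c ℓ₁ ℓ₂) where
  open ℂₚ K public using (ℤₚ; fromℤₚ)
  open ℂₚ K hiding (ℤₚ; fromℤₚ)
  open ValuedField Cₚ public
  open ValuedFieldProperties Cₚ
  open PowerSeries Cₚ public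
  open import Algebra.Definitions.RawSemiring (Semiring.rawSemiring semiring) public
    using (_^_) renaming (_×_ to _·_)
  open import Algebra.Apartness.Properties.HeytingCommutativeRing
    (HeytingField.heytingCommutativeRing heytingField) using (#-congʳ)
  open import Relation.Binary.Reasoning.Setoid setoid

  ⟨_⟩ : ℕ → Carrier
  ⟨ n ⟩ = n · 1#

  private
    1<p : 1 ℕ.< p
    1<p = ℕ.nonTrivial⇒n>1 p {{prime⇒nonTrivial p-prime}}

    p-1≢0 : NonZero (p ∸ 1)
    p-1≢0 = ℕ.>-nonZero (ℕ.m<n⇒0<n∸m 1<p)

  1/[p-1] : ℚ
  1/[p-1] = (+ 1 ℚ./ (p ∸ 1)) {{p-1≢0}}

  -- { r ∈ ℂ_p : |r - 1| < p^(-1/(p-1)) }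
  Disc : Set (c ⊔ ℓ₂)
  Disc = Σ Carrier λ r → ∣ r - 1# ∣<p^- 1/[p-1]

  0<1/[p-1] : 0ℚ ℚ.< 1/[p-1]
  0<1/[p-1] = ℚ.positive⁻¹ 1/[p-1] {{ℚ.normalize-pos 1 (p ∸ 1) {{p-1≢0}}}}

  infixr 8 _^ᴰ_

  _^ᴰ_ : Disc → ℕ → Disc
  (r , hr) ^ᴰ n = r ^ n , pow n
    where
    pow : ∀ n → ∣ r ^ n - 1# ∣<p^- 1/[p-1]
    pow zero    h = contradiction h (#-irrefl (-‿inverseʳ 1#))
    pow (suc n) = ∣∣<-cong (xy-1 r (r ^ n))
      (∣+∣< _ _ (∣*∣< r (r ^ n - 1#) (integral r (ℚ.<⇒≤ 0<1/[p-1]) hr) (pow n)) hr)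

  -- e^{xt}
  exp[_t] : Carrier → Series
  exp[ x t] n = fromℚ ((+ 1 ℚ./ n !) {{n ℕ.!≢0}}) * x ^ n

  -- r e^t + 1
  denominator : Carrier → Series
  denominator r = const r ⊠ exp[ 1# t] ⊞ const 1#

  private
    module I₁ = Embedding ℚ↪Qₚ
    module I₂ = Embedding Qₚ↪Q̄ₚ
    module I₃ = Embedding Q̄ₚ↪Cₚ

    fromℚ-1 : fromℚ 1ℚ ≈ 1#
    fromℚ-1 = trans (I₃.⟦⟧-cong (trans₂ (I₂.⟦⟧-cong I₁.1#-homo) I₂.1#-homo)) I₃.1#-homo
      where trans₂ = ValuedField.trans Q̄ₚ

    fromℚ-+ : ∀ x y → fromℚ (x ℚ.+ y) ≈ fromℚ x + fromℚ y
    fromℚ-+ x y = trans (I₃.⟦⟧-cong (trans₂ (I₂.⟦⟧-cong (I₁.+-homo x y)) (I₂.+-homo _ _)))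
                        (I₃.+-homo _ _)
      where trans₂ = ValuedField.trans Q̄ₚ

    p∤2 : ¬ p ∣ 2
    p∤2 d = ¬odd-2 (≡.subst Odd (ℕ.≤-antisym (∣.∣⇒≤ d) 1<p) p-odd)
      where
      ¬odd-2 : ¬ Odd 2
      ¬odd-2 ()

    2≢0 : ¬ (+ 2 ℚ./ 1 ≡ 0ℚ)
    2≢0 ()

    two#₁ = EmbeddingProperties.to-# ℚ↪Qₚ 2≢0
    two#₂ = EmbeddingProperties.to-# Qₚ↪Q̄ₚ two#₁
    two#₃ = EmbeddingProperties.to-# Q̄ₚ↪Cₚ two#₂

    v-2 : v (fromℚ (+ 2 ℚ./ 1)) two#₃ ≡ 0ℚ
    v-2 = ≡.trans (I₃.v-to _ two#₂ two#₃)
          (≡.trans (I₂.v-to _ two#₁ two#₂)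
          (≡.trans (I₁.v-to _ 2≢0 two#₁) (IsPAdic.v-unit isPAdic 2 p∤2 2≢0)))

    r-1≈r+1-2 : ∀ r → r - 1# ≈ denominator r 0 - fromℚ (+ 2 ℚ./ 1)
    r-1≈r+1-2 r = sym (begin
      denominator r 0 - fromℚ (+ 2 ℚ./ 1)  ≈⟨ +-cong lhs (-‿cong (trans (fromℚ-+ 1ℚ 1ℚ) (+-cong fromℚ-1 fromℚ-1))) ⟩
      (r + 1#) - (1# + 1#)                 ≈⟨ +-congˡ (-‿+-comm 1# 1#) ⟨
      (r + 1#) + (- 1# + - 1#)             ≈⟨ +-assoc _ _ _ ⟨
      ((r + 1#) - 1#) - 1#                 ≈⟨ +-congʳ (+-assoc _ _ _) ⟩
      (r + (1# - 1#)) - 1#                 ≈⟨ +-congʳ (+-congˡ (-‿inverseʳ 1#)) ⟩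
      (r + 0#) - 1#                        ≈⟨ +-congʳ (+-identityʳ r) ⟩
      r - 1#                               ∎)
      where
      open import Algebra.Properties.Ring ring using (-‿+-comm)
      lhs : denominator r 0 ≈ r + 1#
      lhs = +-congʳ (begin
        r * (fromℚ 1ℚ * 1#) + 0#   ≈⟨ +-identityʳ _ ⟩
        r * (fromℚ 1ℚ * 1#)        ≈⟨ *-congˡ (*-identityʳ _) ⟩
        r * fromℚ 1ℚ               ≈⟨ *-congˡ fromℚ-1 ⟩
        r * 1#                     ≈⟨ *-identityʳ r ⟩
        r                          ∎)

  denominator#0 : ((r , _) : Disc) → denominator r 0 # 0#
  denominator#0 (r , hr) = #-open _ _ two#₃ 1/[p-1]
    (≡.subst (ℚ._< 1/[p-1]) (≡.sym v-2) 0<1/[p-1])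
    (∣∣≤-cong (r-1≈r+1-2 r) (λ h → ℚ.<⇒≤ (hr h)))

  -- E_{n,r}(x), i.e. n! times the coefficient of tⁿ in (2 / (r e^t + 1)) e^{xt}
  E : ℕ → Disc → Carrier → Carrier
  E n r x = (n !) · (divide (const ⟨ 2 ⟩) (denominator (proj₁ r)) (denominator#0 r) ⊠ exp[ x t]) n

  -- T_{k,r}(N)
  T : ℕ → Carrier → ℕ → Carrier
  T k r N = ∑≤ N λ i → (- 1#) ^ i * ⟨ i ⟩ ^ k * r ^ i

  -- Sum of f k l m over k + l + m = n.
  ∑₃ : ℕ → (ℕ → ℕ → ℕ → Carrier) → Carrier
  ∑₃ n f = ∑≤ n λ k → ∑≤ (n ∸ k) λ l → f k l (n ∸ k ∸ l)

{-# OPTIONS --safe #-}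

-- With W = w₁w₂w₃ and D_a = q^a e^{at} + 1, the geometric sum gives
--   Σ_l T_{l,q^b}(w - 1) (bt)^l / l! = Σ_{i<w} (- q^b e^{bt})^i = D_{bw} / D_b    for odd w,
-- so the first sum is n! times the coefficient of tⁿ in
--   2 e^{Wyt} D_W² / (D_{w₂w₃} D_{w₁w₃} D_{w₁w₂}),
-- which is symmetric in w₁, w₂, w₃.
module Submission where

open import Defs
open import Level using (Level)
open import Data.Nat.Base as ℕ using (ℕ; zero; suc; _∸_; _!)
open import Data.Nat.Primality using (Prime)
open import Data.Product.Base using (_×_; _,_; proj₁)
open import Algebra.Bundles using (CommutativeRing)
import Algebra.Construct.Pointwise as Pointwise
import Algebra.Properties.CommutativeSemiring.Binomial as Binomial
import Algebra.Properties.CommutativeSemiring.Exp as Exp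
import Algebra.Properties.Ring as RingProperties
import Algebra.Properties.Semiring.Mult as Mult
import Algebra.Properties.Semiring.Sum as Sum
import Algebra.Solver.CommutativeMonoid as CommutativeMonoidSolver
import Data.Fin.Properties as Fin
open import Data.Fin.Base using (toℕ)
open import Data.Integer.Base as ℤ using (+_)
import Data.Integer.Properties as ℤ
open import Data.Nat.Combinatorics using (_C_; nCk≡n!/k![n-k]!; k![n∸k]!∣n!)
import Data.Nat.Divisibility as ℕ
import Data.Nat.DivMod as ℕ
import Data.Nat.Properties as ℕ
open import Data.Nat.Tactic.RingSolver using (solve-∀)
open import Data.Rational.Base as ℚ using (0ℚ; 1ℚ)
import Data.Rational.Properties as ℚ
import Data.Rational.Unnormalised.Base as ℚᵘ
import Data.Rational.Unnormalised.Properties as ℚᵘ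
open import Relation.Binary.PropositionalEquality.Core as ≡ using (_≡_)
import Relation.Binary.Reasoning.Setoid as SetoidReasoning

private variable
  c ℓ ℓ₁ ℓ₂ : Level

-- Identities in an arbitrary commutative ring.

module CommutativeRingProperties (R : CommutativeRing c ℓ) where
  open CommutativeRing R
  open Exp commutativeSemiring
  open Sum semiring using (sum; *-distribˡ-sum)
  open RingProperties ring using (-‿distribˡ-*; -‿distribʳ-*; -‿involutive; -1*x≈-x)
  open CommutativeMonoidSolver *-commutativeMonoid using (solve; _⊕_; _⊜_)
  open SetoidReasoning setoid

  [-x]^n≈[-1]^n*x^n : ∀ x n → (- x) ^ n ≈ (- 1#) ^ n * x ^ n
  [-x]^n≈[-1]^n*x^n x n = begin
    (- x) ^ n            ≈⟨ ^-congˡ n (-1*x≈-x x) ⟨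
    (- 1# * x) ^ n       ≈⟨ ^-distrib-* (- 1#) x n ⟩
    (- 1#) ^ n * x ^ n   ∎

  -- Induction in steps of two: `Odd (suc (suc n))` computes to `Odd n`, and two sign changes
  -- cancel. `Odd 0` is absurd, so the recursion ends at exponent 1.
  [-x]^odd : ∀ x n → Odd n → (- x) ^ n ≈ - (x ^ n)
  [-x]^odd x (suc zero) _ = sym (-‿distribˡ-* x 1#)
  [-x]^odd x (suc (suc n)) n-odd = begin
    - x * (- x * (- x) ^ n)   ≈⟨ *-assoc _ _ _ ⟨
    (- x * - x) * (- x) ^ n   ≈⟨ *-cong square ([-x]^odd x n n-odd) ⟩
    (x * x) * - (x ^ n)       ≈⟨ -‿distribʳ-* _ _ ⟨
    - ((x * x) * x ^ n)       ≈⟨ -‿cong (*-assoc _ _ _) ⟩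
    - (x * (x * x ^ n))       ∎
    where
    square : - x * - x ≈ x * x
    square = begin
      - x * - x      ≈⟨ -‿distribˡ-* x (- x) ⟨
      - (x * - x)    ≈⟨ -‿cong (-‿distribʳ-* x x) ⟨
      - - (x * x)    ≈⟨ -‿involutive _ ⟩
      x * x          ∎

  geometricSum : ℕ → Carrier → Carrier
  geometricSum n x = sum {n} λ i → x ^ toℕ i

  geometricSum-* : ∀ n x → geometricSum n x * (1# - x) ≈ 1# - x ^ n
  geometricSum-* zero x = trans (zeroˡ _) (sym (-‿inverseʳ 1#))
  geometricSum-* (suc n) x = begin
    (1# + sum {n} (λ i → x * x ^ toℕ i)) * (1# - x)   ≈⟨ *-congʳ (+-congˡ (*-distribˡ-sum {n} x (λ i → x ^ toℕ i))) ⟨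
    (1# + x * g) * (1# - x)                           ≈⟨ distribʳ _ _ _ ⟩
    1# * (1# - x) + x * g * (1# - x)                  ≈⟨ +-cong (*-identityˡ _) (*-assoc _ _ _) ⟩
    (1# - x) + x * (g * (1# - x))                     ≈⟨ +-congˡ (*-congˡ (geometricSum-* n x)) ⟩
    (1# - x) + x * (1# - x ^ n)                       ≈⟨ +-congˡ (distribˡ _ _ _) ⟩
    (1# - x) + (x * 1# + x * - x ^ n)                 ≈⟨ +-congˡ (+-cong (*-identityʳ x) (sym (-‿distribʳ-* _ _))) ⟩
    (1# - x) + (x - x * x ^ n)                        ≈⟨ +-assoc _ _ _ ⟩
    1# + (- x + (x - x * x ^ n))                      ≈⟨ +-congˡ (+-assoc _ _ _) ⟨
    1# + ((- x + x) - x * x ^ n)                      ≈⟨ +-congˡ (+-congʳ (-‿inverseˡ x)) ⟩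
    1# + (0# - x * x ^ n)                             ≈⟨ +-congˡ (+-identityˡ _) ⟩
    1# - x ^ suc n                                    ∎
    where g = geometricSum n x

  -- The geometric sum formula at `- x`, where oddness turns the sign of the last power into a plus.
  -- Applied to a series q^a e^{at}, it expresses the power sums through the denominators of the
  -- Euler polynomials.
  alternatingSum-* : ∀ n x → Odd n → geometricSum n (- x) * (x + 1#) ≈ x ^ n + 1#
  alternatingSum-* n x n-odd = begin
    geometricSum n (- x) * (x + 1#)      ≈⟨ *-congˡ (trans (+-comm _ _) (+-congˡ (sym (-‿involutive x)))) ⟩
    geometricSum n (- x) * (1# - - x)    ≈⟨ geometricSum-* n (- x) ⟩
    1# - (- x) ^ n                       ≈⟨ +-congˡ (-‿cong ([-x]^odd x n n-odd)) ⟩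
    1# - - x ^ n                         ≈⟨ +-congˡ (-‿involutive _) ⟩
    1# + x ^ n                           ≈⟨ +-comm _ _ ⟩
    x ^ n + 1#                           ∎

  -- Division by an element with a known inverse. It serves in ℂ_p for quotients of natural numbers
  -- and in the ring of power series for quotients of generating functions.
  x*y≈z⇒x≈z*y⁻¹ : ∀ {x y y⁻¹ z} → x * y ≈ z → y * y⁻¹ ≈ 1# → x ≈ z * y⁻¹
  x*y≈z⇒x≈z*y⁻¹ {x} {y} {y⁻¹} {z} xy≈z yy⁻¹≈1 = begin
    x               ≈⟨ *-identityʳ x ⟨
    x * 1#          ≈⟨ *-congˡ yy⁻¹≈1 ⟨
    x * (y * y⁻¹)   ≈⟨ *-assoc _ _ _ ⟨
    x * y * y⁻¹     ≈⟨ *-congʳ xy≈z ⟩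
    z * y⁻¹         ∎

  *-interchange : ∀ w x y z → (w * x) * (y * z) ≈ (w * y) * (x * z)
  *-interchange = solve 4 (λ w x y z → (w ⊕ x) ⊕ (y ⊕ z) ⊜ (w ⊕ y) ⊕ (x ⊕ z)) refl

  -- With `z` = 2, `u` = e^{Wyt}, `v` = D_W and `x`, `y`, `w` the inverses of three denominators,
  -- the left side is the product of the three generating functions and the right side is
  -- `symmetricForm`.
  collect-quotients : ∀ z u v x y w →
    ((z * x) * u) * ((v * y) * (v * w)) ≈ ((z * u) * (v * v)) * ((x * y) * w)
  collect-quotients = solve 6 (λ z u v x y w →
    ((z ⊕ x) ⊕ u) ⊕ ((v ⊕ y) ⊕ (v ⊕ w)) ⊜ ((z ⊕ u) ⊕ (v ⊕ v)) ⊕ ((x ⊕ y) ⊕ w)) refl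

-- The ring of formal power series and the substitution t ↦ at.

module SeriesProperties (A : ValuedField c ℓ₁ ℓ₂) where
  open ValuedField A
  open CommutativeRing commutativeRing using (commutativeSemiring)
  open PowerSeries A
  open Exp commutativeSemiring
  open Sum semiring using (sum-cong-≋; *-distribˡ-sum; ∑-distrib-+)
  open CommutativeRingProperties commutativeRing using (*-interchange)
  open SetoidReasoning setoid

  infix 4 _≋_

  _≋_ : Series → Series → Set _
  f ≋ g = ∀ n → f n ≈ g n

  -- The bound `i ≤ n` is handed to the hypothesis because summands contain the truncated difference
  -- `n ∸ i`, which is a true difference only under it.
  ∑≤-cong : ∀ n {f g : ℕ → Carrier} → (∀ i → i ℕ.≤ n → f i ≈ g i) → ∑≤ n f ≈ ∑≤ n g
  ∑≤-cong n f≈g = sum-cong-≋ {suc n} λ i → f≈g (toℕ i) (Fin.toℕ≤pred[n] i)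

  *-distribˡ-∑≤ : ∀ n x (f : ℕ → Carrier) → x * ∑≤ n f ≈ ∑≤ n λ i → x * f i
  *-distribˡ-∑≤ n x f = *-distribˡ-sum {suc n} x λ i → f (toℕ i)

  0ˢ : Series
  0ˢ _ = 0#

  ⊟_ : Series → Series
  (⊟ f) n = - f n

  tail : Series → Series
  tail f n = f (suc n)

  ⊠-cong : ∀ {f f′ g g′} → f ≋ f′ → g ≋ g′ → f ⊠ g ≋ f′ ⊠ g′
  ⊠-cong f≋f′ g≋g′ n = ∑≤-cong n λ i _ → *-cong (f≋f′ i) (g≋g′ (n ∸ i))

  ⊠-distribʳ-⊞ : ∀ h f g → (f ⊞ g) ⊠ h ≋ f ⊠ h ⊞ g ⊠ h
  ⊠-distribʳ-⊞ h f g n = trans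
    (∑≤-cong n λ i _ → distribʳ (h (n ∸ i)) (f i) (g i))
    (∑-distrib-+ {suc n} (λ i → f (toℕ i) * h (n ∸ toℕ i)) (λ i → g (toℕ i) * h (n ∸ toℕ i)))

  -- The product unfolds by definition at the head of its left factor. This is the mirror rule for
  -- the right factor, and commutativity follows by comparing the two.
  ⊠-sucʳ : ∀ f g n → (f ⊠ g) (suc n) ≈ g 0 * f (suc n) + (f ⊠ tail g) n
  ⊠-sucʳ f g zero = begin
    f 0 * g 1 + (f 1 * g 0 + 0#)   ≈⟨ +-congˡ (+-identityʳ _) ⟩
    f 0 * g 1 + f 1 * g 0          ≈⟨ +-comm _ _ ⟩
    f 1 * g 0 + f 0 * g 1          ≈⟨ +-cong (*-comm _ _) (sym (+-identityʳ _)) ⟩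
    g 0 * f 1 + (f 0 * g 1 + 0#)   ∎
  ⊠-sucʳ f g (suc n) = begin
    x + (tail f ⊠ g) (suc n)                    ≈⟨ +-congˡ (⊠-sucʳ (tail f) g n) ⟩
    x + (y + (tail f ⊠ tail g) n)               ≈⟨ +-assoc _ _ _ ⟨
    (x + y) + (tail f ⊠ tail g) n               ≈⟨ +-congʳ (+-comm x y) ⟩
    (y + x) + (tail f ⊠ tail g) n               ≈⟨ +-assoc _ _ _ ⟩
    y + (x + (tail f ⊠ tail g) n)               ∎
    where
    x = f 0 * g (suc (suc n))
    y = g 0 * f (suc (suc n))

  ⊠-comm : ∀ f g → f ⊠ g ≋ g ⊠ f
  ⊠-comm f g zero = +-congʳ (*-comm _ _)
  ⊠-comm f g (suc n) = begin
    f 0 * g (suc n) + (tail f ⊠ g) n   ≈⟨ +-congˡ (⊠-comm (tail f) g n) ⟩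
    f 0 * g (suc n) + (g ⊠ tail f) n   ≈⟨ ⊠-sucʳ g f n ⟨
    (g ⊠ f) (suc n)                    ∎

  const-⊠ : ∀ a f n → (const a ⊠ f) n ≈ a * f n
  const-⊠ a f zero = +-identityʳ _
  const-⊠ a f (suc n) = trans (+-congˡ (0ˢ-⊠ n)) (+-identityʳ _)
    where
    0ˢ-⊠ : ∀ n → (0ˢ ⊠ f) n ≈ 0#
    0ˢ-⊠ zero    = trans (+-identityʳ _) (zeroˡ _)
    0ˢ-⊠ (suc n) = trans (+-cong (zeroˡ _) (0ˢ-⊠ n)) (+-identityʳ _)

  -- Induction on the coefficient, driven by `tail-⊠`: the tail of `f ⊠ g` is `f 0` times the tail
  -- of `g`, plus `tail f ⊠ g`. This avoids any reindexing of a double sum.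
  ⊠-assoc : ∀ f g h → (f ⊠ g) ⊠ h ≋ f ⊠ (g ⊠ h)
  ⊠-assoc f g h zero = begin
    (f 0 * g 0 + 0#) * h 0 + 0#   ≈⟨ +-congʳ (*-congʳ (+-identityʳ _)) ⟩
    (f 0 * g 0) * h 0 + 0#        ≈⟨ +-congʳ (*-assoc _ _ _) ⟩
    f 0 * (g 0 * h 0) + 0#        ≈⟨ +-congʳ (*-congˡ (+-identityʳ _)) ⟨
    f 0 * (g 0 * h 0 + 0#) + 0#   ∎
  ⊠-assoc f g h (suc n) = begin
    (f 0 * g 0 + 0#) * x + (tail (f ⊠ g) ⊠ h) n
      ≈⟨ +-cong (trans (*-congʳ (+-identityʳ _)) (*-assoc _ _ _)) (⊠-cong {g = h} {h} tail-⊠ (λ _ → refl) n) ⟩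
    f 0 * (g 0 * x) + ((const (f 0) ⊠ tail g ⊞ tail f ⊠ g) ⊠ h) n
      ≈⟨ +-congˡ (⊠-distribʳ-⊞ h (const (f 0) ⊠ tail g) (tail f ⊠ g) n) ⟩
    f 0 * (g 0 * x) + (((const (f 0) ⊠ tail g) ⊠ h) n + ((tail f ⊠ g) ⊠ h) n)
      ≈⟨ +-congˡ (+-cong const-assoc (⊠-assoc (tail f) g h n)) ⟩
    f 0 * (g 0 * x) + (f 0 * (tail g ⊠ h) n + (tail f ⊠ (g ⊠ h)) n)
      ≈⟨ +-assoc _ _ _ ⟨
    f 0 * (g 0 * x) + f 0 * (tail g ⊠ h) n + (tail f ⊠ (g ⊠ h)) n
      ≈⟨ +-congʳ (distribˡ _ _ _) ⟨
    f 0 * (g 0 * x + (tail g ⊠ h) n) + (tail f ⊠ (g ⊠ h)) n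
      ∎
    where
    x = h (suc n)

    tail-⊠ : tail (f ⊠ g) ≋ const (f 0) ⊠ tail g ⊞ tail f ⊠ g
    tail-⊠ m = +-congʳ (sym (const-⊠ (f 0) (tail g) m))

    const-assoc : ((const (f 0) ⊠ tail g) ⊠ h) n ≈ f 0 * (tail g ⊠ h) n
    const-assoc = begin
      ((const (f 0) ⊠ tail g) ⊠ h) n
        ≈⟨ ∑≤-cong n (λ i _ → trans (*-congʳ (const-⊠ (f 0) (tail g) i)) (*-assoc _ _ (h (n ∸ i)))) ⟩
      ∑≤ n (λ i → f 0 * (tail g i * h (n ∸ i)))
        ≈⟨ *-distribˡ-∑≤ n (f 0) (λ i → tail g i * h (n ∸ i)) ⟨
      f 0 * (tail g ⊠ h) n
        ∎

  ⊠-identityˡ : ∀ f → const 1# ⊠ f ≋ f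
  ⊠-identityˡ f n = trans (const-⊠ 1# f n) (*-identityˡ _)

  seriesRing : CommutativeRing _ _
  seriesRing = record
    { Carrier = Series
    ; _≈_ = _≋_
    ; _+_ = _⊞_
    ; _*_ = _⊠_
    ; -_ = ⊟_
    ; 0# = 0ˢ
    ; 1# = const 1#
    ; isCommutativeRing = record
      { isRing = record
        { +-isAbelianGroup = Pointwise.isAbelianGroup ℕ +-isAbelianGroup
        ; *-cong = ⊠-cong
        ; *-assoc = ⊠-assoc
        ; *-identity = ⊠-identityˡ , λ f n → trans (⊠-comm f (const 1#) n) (⊠-identityˡ f n)
        ; distrib = (λ h f g n → trans (⊠-comm h (f ⊞ g) n) (trans (⊠-distribʳ-⊞ h f g n)
                                   (+-cong (⊠-comm f h n) (⊠-comm g h n))))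
                  , ⊠-distribʳ-⊞
        }
      ; *-comm = ⊠-comm
      }
    }

  const-* : ∀ a b → const (a * b) ≋ const a ⊠ const b
  const-* a b zero    = sym (const-⊠ a (const b) 0)
  const-* a b (suc n) = sym (trans (const-⊠ a (const b) (suc n)) (zeroʳ a))

  -- The substitution t ↦ a t.
  scale : Carrier → Series → Series
  scale a f n = a ^ n * f n

  scale-cong : ∀ a {f g} → f ≋ g → scale a f ≋ scale a g
  scale-cong a f≋g n = *-congˡ (f≋g n)

  scale-const : ∀ a b → scale a (const b) ≋ const b
  scale-const a b zero    = *-identityˡ b
  scale-const a b (suc n) = zeroʳ _

  scale-⊞ : ∀ a f g → scale a (f ⊞ g) ≋ scale a f ⊞ scale a g
  scale-⊞ a f g n = distribˡ _ _ _

  -- The power of `a` at degree `n` splits between the degrees `i` and `n ∸ i` of the two factors.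
  scale-⊠ : ∀ a f g → scale a (f ⊠ g) ≋ scale a f ⊠ scale a g
  scale-⊠ a f g n = begin
    a ^ n * (f ⊠ g) n
      ≈⟨ *-distribˡ-∑≤ n (a ^ n) (λ i → f i * g (n ∸ i)) ⟩
    ∑≤ n (λ i → a ^ n * (f i * g (n ∸ i)))
      ≈⟨ ∑≤-cong n (λ i i≤n → trans (*-congʳ (split i i≤n))
           (*-interchange (a ^ i) (a ^ (n ∸ i)) (f i) (g (n ∸ i)))) ⟩
    (scale a f ⊠ scale a g) n
      ∎
    where
    split : ∀ i → i ℕ.≤ n → a ^ n ≈ a ^ i * a ^ (n ∸ i)
    split i i≤n = trans (^-congʳ a (≡.sym (ℕ.m+[n∸m]≡n i≤n))) (^-homo-* a i (n ∸ i))

-- Exact factorial quotients in ℕ and reciprocals in ℚ.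

k!l!m!∣n! : ∀ n k l → k ℕ.≤ n → l ℕ.≤ n ∸ k → k ! ℕ.* l ! ℕ.* (n ∸ k ∸ l) ! ℕ.∣ n !
k!l!m!∣n! n k l k≤n l≤n∸k = ℕ.∣-trans
  (≡.subst (ℕ._∣ k ! ℕ.* (n ∸ k) !) (≡.sym (ℕ.*-assoc (k !) (l !) _))
    (ℕ.*-monoʳ-∣ (k !) (k![n∸k]!∣n! l≤n∸k)))
  (k![n∸k]!∣n! k≤n)

-- `multinomial` is a truncating quotient. It is exact because l! m! divides (n - k)! and k! (n -
-- k)! divides n!.
multinomial-* : ∀ n k l → k ℕ.≤ n → l ℕ.≤ n ∸ k →
  multinomial n k l (n ∸ k ∸ l) ℕ.* (k ! ℕ.* l ! ℕ.* (n ∸ k ∸ l) !) ≡ n !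
multinomial-* n k l k≤n l≤n∸k = ℕ.m/n*n≡m
  {{ℕ.m*n≢0 (k ! ℕ.* l !) ((n ∸ k ∸ l) !) {{k ℕ.!* l !≢0}} {{(n ∸ k ∸ l) ℕ.!≢0}}}}
  (k!l!m!∣n! n k l k≤n l≤n∸k)

C-* : ∀ n k → k ℕ.≤ n → (n C k) ℕ.* (k ! ℕ.* (n ∸ k) !) ≡ n !
C-* n k k≤n = ≡.trans
  (≡.cong (ℕ._* (k ! ℕ.* (n ∸ k) !)) (nCk≡n!/k![n-k]! k≤n))
  (ℕ.m/n*n≡m {{k ℕ.!* (n ∸ k) !≢0}} (k![n∸k]!∣n! k≤n))

-- `ℚ` keeps fractions reduced, and the gcd does not compute at a variable `n`. In the unnormalised
-- rationals the claim becomes an identity of integers.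
[1+n]/1≡1+n/1 : ∀ n → + suc n ℚ./ 1 ≡ 1ℚ ℚ.+ (+ n ℚ./ 1)
[1+n]/1≡1+n/1 n = ℚ.toℚᵘ-injective (begin
  ℚ.toℚᵘ (+ suc n ℚ./ 1)                  ≈⟨ ℚ.toℚᵘ-fromℚᵘ (ℚᵘ.mkℚᵘ (+ suc n) 0) ⟩
  ℚᵘ.mkℚᵘ (+ suc n) 0                     ≈⟨ ℚᵘ.*≡* (≡.cong (λ z → (+ 1 ℤ.+ z) ℤ.* + 1) (≡.sym (ℤ.*-identityʳ (+ n)))) ⟩
  ℚᵘ.1ℚᵘ ℚᵘ.+ ℚᵘ.mkℚᵘ (+ n) 0             ≈⟨ ℚᵘ.+-congʳ ℚᵘ.1ℚᵘ (ℚ.toℚᵘ-fromℚᵘ (ℚᵘ.mkℚᵘ (+ n) 0)) ⟨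
  ℚᵘ.1ℚᵘ ℚᵘ.+ ℚ.toℚᵘ (+ n ℚ./ 1)          ≈⟨ ℚ.toℚᵘ-homo-+ 1ℚ (+ n ℚ./ 1) ⟨
  ℚ.toℚᵘ (1ℚ ℚ.+ (+ n ℚ./ 1))             ∎)
  where
  open SetoidReasoning ℚᵘ.≃-setoid

n/1*1/n≡1 : ∀ n .{{_ : ℕ.NonZero n}} → (+ n ℚ./ 1) ℚ.* (+ 1 ℚ./ n) ≡ 1ℚ
n/1*1/n≡1 (suc n) = ℚ.toℚᵘ-injective (begin
  ℚ.toℚᵘ ((+ suc n ℚ./ 1) ℚ.* (+ 1 ℚ./ suc n))
    ≈⟨ ℚ.toℚᵘ-homo-* (+ suc n ℚ./ 1) (+ 1 ℚ./ suc n) ⟩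
  ℚ.toℚᵘ (+ suc n ℚ./ 1) ℚᵘ.* ℚ.toℚᵘ (+ 1 ℚ./ suc n)
    ≈⟨ ℚᵘ.*-cong (ℚ.toℚᵘ-fromℚᵘ (ℚᵘ.mkℚᵘ (+ suc n) 0)) (ℚ.toℚᵘ-fromℚᵘ (ℚᵘ.mkℚᵘ (+ 1) n)) ⟩
  ℚᵘ.mkℚᵘ (+ suc n) 0 ℚᵘ.* ℚᵘ.mkℚᵘ (+ 1) n
    ≈⟨ ℚᵘ.*≡* (≡.cong +_ (lemma n)) ⟩
  ℚᵘ.1ℚᵘ
    ∎)
  where
  open SetoidReasoning ℚᵘ.≃-setoid
  lemma : ∀ n → suc n ℕ.* 1 ℕ.* 1 ≡ 1 ℕ.* (1 ℕ.* suc n)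
  lemma = solve-∀

-- Factorials and their inverses in ℂ_p.

module EulerProperties (p : ℕ) (p-prime : Prime p) (p-odd : Odd p) (K : ℂₚ p c ℓ₁ ℓ₂) where
  open Euler p p-prime p-odd K
  open ℂₚ K using (ℚ↪Qₚ; Qₚ↪Q̄ₚ; Q̄ₚ↪Cₚ; Q̄ₚ; Cₚ; fromℚ)
  open SeriesProperties Cₚ
  open CommutativeRing commutativeRing using (commutativeSemiring; *-commutativeMonoid)
  open Exp commutativeSemiring using (^-congˡ; ^-homo-*; ^-assocʳ; ^-distrib-*)
  open Mult semiring using (×-congʳ; ×-assoc-*; ×1-homo-*)
  open CommutativeRingProperties commutativeRing using ([-x]^n≈[-1]^n*x^n; x*y≈z⇒x≈z*y⁻¹; *-interchange)
  open CommutativeMonoidSolver *-commutativeMonoid using (solve; _⊕_; _⊜_)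
  open SetoidReasoning setoid

  private
    module S = CommutativeRing seriesRing
    module SExp = Exp S.commutativeSemiring
    module SProps = CommutativeRingProperties seriesRing
    module I₁ = Embedding ℚ↪Qₚ
    module I₂ = Embedding Qₚ↪Q̄ₚ
    module I₃ = Embedding Q̄ₚ↪Cₚ

  infixr 8 _^ˢ_

  _^ˢ_ : Series → ℕ → Series
  _^ˢ_ = SExp._^_

  n·x≈⟨n⟩*x : ∀ n x → n · x ≈ ⟨ n ⟩ * x
  n·x≈⟨n⟩*x n x = sym (trans (×-assoc-* n 1# x) (×-congʳ n (*-identityˡ x)))

  ⟨⟩-cong : ∀ {m n} → m ≡ n → ⟨ m ⟩ ≈ ⟨ n ⟩
  ⟨⟩-cong ≡.refl = refl

  ⟨⟩-* : ∀ m n → ⟨ m ℕ.* n ⟩ ≈ ⟨ m ⟩ * ⟨ n ⟩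
  ⟨⟩-* = ×1-homo-*

  fromℚ-1 : fromℚ 1ℚ ≈ 1#
  fromℚ-1 = trans (I₃.⟦⟧-cong (ValuedField.trans Q̄ₚ (I₂.⟦⟧-cong I₁.1#-homo) I₂.1#-homo)) I₃.1#-homo

  fromℚ-0 : fromℚ 0ℚ ≈ 0#
  fromℚ-0 = trans (I₃.⟦⟧-cong (ValuedField.trans Q̄ₚ (I₂.⟦⟧-cong I₁.0#-homo) I₂.0#-homo)) I₃.0#-homo

  fromℚ-+ : ∀ x y → fromℚ (x ℚ.+ y) ≈ fromℚ x + fromℚ y
  fromℚ-+ x y = trans
    (I₃.⟦⟧-cong (ValuedField.trans Q̄ₚ (I₂.⟦⟧-cong (I₁.+-homo x y)) (I₂.+-homo _ _)))
    (I₃.+-homo _ _)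

  fromℚ-* : ∀ x y → fromℚ (x ℚ.* y) ≈ fromℚ x * fromℚ y
  fromℚ-* x y = trans
    (I₃.⟦⟧-cong (ValuedField.trans Q̄ₚ (I₂.⟦⟧-cong (I₁.*-homo x y)) (I₂.*-homo _ _)))
    (I₃.*-homo _ _)

  fromℚ-n/1 : ∀ n → fromℚ (+ n ℚ./ 1) ≈ ⟨ n ⟩
  fromℚ-n/1 zero = fromℚ-0
  fromℚ-n/1 (suc n) = begin
    fromℚ (+ suc n ℚ./ 1)            ≡⟨ ≡.cong fromℚ ([1+n]/1≡1+n/1 n) ⟩
    fromℚ (1ℚ ℚ.+ (+ n ℚ./ 1))       ≈⟨ fromℚ-+ 1ℚ (+ n ℚ./ 1) ⟩
    fromℚ 1ℚ + fromℚ (+ n ℚ./ 1)     ≈⟨ +-cong fromℚ-1 (fromℚ-n/1 n) ⟩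
    1# + ⟨ n ⟩                       ∎

  1/_! : ℕ → Carrier
  1/ n ! = fromℚ ((+ 1 ℚ./ n !) {{n ℕ.!≢0}})

  n!*1/n!≈1 : ∀ n → ⟨ n ! ⟩ * 1/ n ! ≈ 1#
  n!*1/n!≈1 n = begin
    ⟨ n ! ⟩ * 1/ n !                               ≈⟨ *-congʳ (fromℚ-n/1 (n !)) ⟨
    fromℚ (+ (n !) ℚ./ 1) * 1/ n !                 ≈⟨ fromℚ-* _ _ ⟨
    fromℚ ((+ (n !) ℚ./ 1) ℚ.* (+ 1 ℚ./ n !))      ≡⟨ ≡.cong fromℚ (n/1*1/n≡1 (n !)) ⟩
    fromℚ 1ℚ                                       ≈⟨ fromℚ-1 ⟩
    1#                                             ∎
    where
    instance
      n!≢0 : ℕ.NonZero (n !)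
      n!≢0 = n ℕ.!≢0

  -- Turns an exact quotient of natural numbers into a product in ℂ_p, where binomial and
  -- multinomial coefficients can be regrouped by commutativity.
  ⟨quotient⟩ : ∀ a b c {b⁻¹} → a ℕ.* b ≡ c → ⟨ b ⟩ * b⁻¹ ≈ 1# → ⟨ a ⟩ ≈ ⟨ c ⟩ * b⁻¹
  ⟨quotient⟩ a b c ab≡c = x*y≈z⇒x≈z*y⁻¹
    (trans (sym (⟨⟩-* a b)) (⟨⟩-cong ab≡c))

  ⟨C⟩ : ∀ n k → k ℕ.≤ n → ⟨ n C k ⟩ ≈ ⟨ n ! ⟩ * (1/ k ! * 1/ (n ∸ k) !)
  ⟨C⟩ n k k≤n = ⟨quotient⟩ (n C k) (k ! ℕ.* j !) (n !) (C-* n k k≤n) (begin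
    ⟨ k ! ℕ.* j ! ⟩ * (1/ k ! * 1/ j !)         ≈⟨ *-congʳ (⟨⟩-* (k !) (j !)) ⟩
    ⟨ k ! ⟩ * ⟨ j ! ⟩ * (1/ k ! * 1/ j !)       ≈⟨ *-interchange _ _ _ _ ⟩
    ⟨ k ! ⟩ * 1/ k ! * (⟨ j ! ⟩ * 1/ j !)       ≈⟨ *-cong (n!*1/n!≈1 k) (n!*1/n!≈1 j) ⟩
    1# * 1#                                     ≈⟨ *-identityˡ _ ⟩
    1#                                          ∎)
    where j = n ∸ k

  ⟨multinomial⟩ : ∀ n k l → k ℕ.≤ n → l ℕ.≤ n ∸ k → let m = n ∸ k ∸ l in
    ⟨ multinomial n k l m ⟩ ≈ ⟨ n ! ⟩ * (1/ k ! * 1/ l ! * 1/ m !)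
  ⟨multinomial⟩ n k l k≤n l≤n∸k = ⟨quotient⟩ (multinomial n k l m) (k ! ℕ.* l ! ℕ.* m !) (n !) (multinomial-* n k l k≤n l≤n∸k) (begin
    ⟨ k ! ℕ.* l ! ℕ.* m ! ⟩ * (1/ k ! * 1/ l ! * 1/ m !)
      ≈⟨ *-congʳ (trans (⟨⟩-* (k ! ℕ.* l !) (m !)) (*-congʳ (⟨⟩-* (k !) (l !)))) ⟩
    ⟨ k ! ⟩ * ⟨ l ! ⟩ * ⟨ m ! ⟩ * (1/ k ! * 1/ l ! * 1/ m !)
      ≈⟨ solve 6 (λ x y z u v w → ((x ⊕ y) ⊕ z) ⊕ ((u ⊕ v) ⊕ w) ⊜ ((x ⊕ u) ⊕ (y ⊕ v)) ⊕ (z ⊕ w)) refl _ _ _ _ _ _ ⟩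
    ⟨ k ! ⟩ * 1/ k ! * (⟨ l ! ⟩ * 1/ l !) * (⟨ m ! ⟩ * 1/ m !)
      ≈⟨ *-cong (*-cong (n!*1/n!≈1 k) (n!*1/n!≈1 l)) (n!*1/n!≈1 m) ⟩
    1# * 1# * 1#
      ≈⟨ trans (*-identityʳ _) (*-identityˡ _) ⟩
    1#
      ∎)
    where m = n ∸ k ∸ l

  -- Exponential series.

  exp-cong : ∀ {x y} → x ≈ y → exp[ x t] ≋ exp[ y t]
  exp-cong x≈y n = *-congˡ (^-congˡ n x≈y)

  exp-0 : exp[ 0# t] ≋ const 1#
  exp-0 zero    = trans (*-identityʳ _) fromℚ-1
  exp-0 (suc n) = trans (*-congˡ (zeroˡ _)) (zeroʳ _)

  -- Coefficientwise this is the binomial theorem divided by n!.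
  exp-+ : ∀ x y → exp[ x t] ⊠ exp[ y t] ≋ exp[ x + y t]
  exp-+ x y n = begin
    (exp[ x t] ⊠ exp[ y t]) n
      ≈⟨ ∑≤-cong n term ⟩
    ∑≤ n (λ i → 1/ n ! * ((n C i) · (x ^ i * y ^ (n ∸ i))))
      ≈⟨ *-distribˡ-∑≤ n (1/ n !) (λ i → (n C i) · (x ^ i * y ^ (n ∸ i))) ⟨
    1/ n ! * ∑≤ n (λ i → (n C i) · (x ^ i * y ^ (n ∸ i)))
      ≈⟨ *-congˡ (Binomial.theorem commutativeSemiring n x y) ⟨
    1/ n ! * (x + y) ^ n
      ∎
    where
    term : ∀ i → i ℕ.≤ n → 1/ i ! * x ^ i * (1/ (n ∸ i) ! * y ^ (n ∸ i)) ≈ 1/ n ! * ((n C i) · (x ^ i * y ^ (n ∸ i)))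
    term i i≤n = sym (begin
      1/ n ! * ((n C i) · (x ^ i * y ^ j))
        ≈⟨ *-congˡ (trans (n·x≈⟨n⟩*x (n C i) _) (*-congʳ (⟨C⟩ n i i≤n))) ⟩
      1/ n ! * (⟨ n ! ⟩ * (1/ i ! * 1/ j !) * (x ^ i * y ^ j))
        ≈⟨ solve 6 (λ a b c d e f → a ⊕ ((b ⊕ (c ⊕ d)) ⊕ (e ⊕ f)) ⊜ (b ⊕ a) ⊕ ((c ⊕ e) ⊕ (d ⊕ f))) refl _ _ _ _ _ _ ⟩
      ⟨ n ! ⟩ * 1/ n ! * (1/ i ! * x ^ i * (1/ j ! * y ^ j))
        ≈⟨ trans (*-congʳ (n!*1/n!≈1 n)) (*-identityˡ _) ⟩
      1/ i ! * x ^ i * (1/ j ! * y ^ j)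
        ∎)
      where j = n ∸ i

  scale-exp : ∀ a x → scale a exp[ x t] ≋ exp[ a * x t]
  scale-exp a x n = begin
    a ^ n * (1/ n ! * x ^ n)     ≈⟨ solve 3 (λ u v w → u ⊕ (v ⊕ w) ⊜ v ⊕ (u ⊕ w)) refl _ _ _ ⟩
    1/ n ! * (a ^ n * x ^ n)     ≈⟨ *-congˡ (^-distrib-* a x n) ⟨
    1/ n ! * (a * x) ^ n         ∎

  infix 9 _e^[_t]

  -- The scalar and the exponent vary independently. Such series are closed under products, powers
  -- and negation, as the geometric sum requires.
  _e^[_t] : Carrier → Carrier → Series
  r e^[ x t] = const r ⊠ exp[ x t]

  const-cong : ∀ {r s} → r ≈ s → const r ≋ const s
  const-cong r≈s zero    = r≈s
  const-cong r≈s (suc n) = refl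

  rexp-cong : ∀ {r s x y} → r ≈ s → x ≈ y → r e^[ x t] ≋ s e^[ y t]
  rexp-cong r≈s x≈y = ⊠-cong (const-cong r≈s) (exp-cong x≈y)

  rexp-⊠ : ∀ r s x y → r e^[ x t] ⊠ s e^[ y t] ≋ (r * s) e^[ x + y t]
  rexp-⊠ r s x y = S.trans
    (SProps.*-interchange (const r) exp[ x t] (const s) exp[ y t])
    (⊠-cong (S.sym (const-* r s)) (exp-+ x y))

  rexp-^ : ∀ r x n → r e^[ x t] ^ˢ n ≋ (r ^ n) e^[ n · x t]
  rexp-^ r x zero    = S.sym (S.trans (⊠-cong {const 1#} S.refl exp-0) (⊠-identityˡ (const 1#)))
  rexp-^ r x (suc n) = S.trans (⊠-cong {r e^[ x t]} S.refl (rexp-^ r x n)) (rexp-⊠ r (r ^ n) x (n · x))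

  ⊟-rexp : ∀ r x → ⊟ (r e^[ x t]) ≋ (- r) e^[ x t]
  ⊟-rexp r x n = begin
    - (r e^[ x t]) n          ≈⟨ -‿cong (const-⊠ r exp[ x t] n) ⟩
    - (r * exp[ x t] n)        ≈⟨ -‿distribˡ-* r _ ⟩
    - r * exp[ x t] n          ≈⟨ const-⊠ (- r) exp[ x t] n ⟨
    ((- r) e^[ x t]) n        ∎
    where open RingProperties ring using (-‿distribˡ-*)

  -- Quotients by r e^{at} + 1 and generating functions of power sums.

  scale-denominator : ∀ a r → scale a (denominator r) ≋ r e^[ a t] ⊞ const 1#
  scale-denominator a r = S.trans (scale-⊞ a (const r ⊠ exp[ 1# t]) (const 1#))
    (S.+-cong
      (S.trans (scale-⊠ a (const r) exp[ 1# t])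
        (⊠-cong (scale-const a r) (S.trans (scale-exp a 1#) (exp-cong (*-identityʳ a)))))
      (scale-const a 1#))

  -- b / (r e^{at} + 1)
  quotient : Carrier → Disc → Carrier → Series
  quotient b r a = scale a (divide (const b) (denominator (proj₁ r)) (denominator#0 r))

  -- The defining property of long division, transported along t ↦ at, which respects products and
  -- fixes constants.
  quotient-⊠ : ∀ b r a → quotient b r a ⊠ (proj₁ r e^[ a t] ⊞ const 1#) ≋ const b
  quotient-⊠ b r a = S.trans (⊠-cong {quotient b r a} S.refl (S.sym (scale-denominator a (proj₁ r))))
    (S.trans (S.sym (scale-⊠ a d (denominator (proj₁ r))))
    (S.trans (scale-cong a (divide-⊠ (const b) (denominator (proj₁ r)) (denominator#0 r)))
             (scale-const a b)))
    where d = divide (const b) (denominator (proj₁ r)) (denominator#0 r)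

  -- Σ_l T_{l,r}(N) (at)^l / l!
  T-series : Carrier → ℕ → Carrier → Series
  T-series r N a l = a ^ l * (1/ l ! * T l r N)

  sum-coefficient : ∀ m (f : ℕ → Series) n →
    Sum.sum S.semiring {m} (λ i → f (toℕ i)) n ≈ Sum.sum semiring {m} (λ i → f (toℕ i) n)
  sum-coefficient zero    f n = refl
  sum-coefficient (suc m) f n = +-congˡ (sum-coefficient m (λ i → f (suc i)) n)

  -- The coefficient of t^l in (- r e^{at})^i is (-1)^i r^i (ia)^l / l!, and the sum over `i` is
  -- taken degree by degree. The range 0..N has `suc N` terms; at `i = 0`, `l = 0` both sides use
  -- 0^0 = 1.
  T-series-geometricSum : ∀ r N a → T-series r N a ≋ SProps.geometricSum (suc N) (⊟ (r e^[ a t]))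
  T-series-geometricSum r N a l = begin
    a ^ l * (1/ l ! * T l r N)
      ≈⟨ *-assoc _ _ _ ⟨
    a ^ l * 1/ l ! * T l r N
      ≈⟨ *-distribˡ-∑≤ N _ (λ i → (- 1#) ^ i * ⟨ i ⟩ ^ l * r ^ i) ⟩
    ∑≤ N (λ i → a ^ l * 1/ l ! * ((- 1#) ^ i * ⟨ i ⟩ ^ l * r ^ i))
      ≈⟨ ∑≤-cong N (λ i _ → term i) ⟩
    ∑≤ N (λ i → ((⊟ (r e^[ a t])) ^ˢ i) l)
      ≈⟨ sum-coefficient (suc N) (λ i → (⊟ (r e^[ a t])) ^ˢ i) l ⟨
    SProps.geometricSum (suc N) (⊟ (r e^[ a t])) l
      ∎
    where
    term : ∀ i → a ^ l * 1/ l ! * ((- 1#) ^ i * ⟨ i ⟩ ^ l * r ^ i) ≈ ((⊟ (r e^[ a t])) ^ˢ i) l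
    term i = sym (begin
      ((⊟ (r e^[ a t])) ^ˢ i) l
        ≈⟨ SExp.^-congˡ i (⊟-rexp r a) l ⟩
      (((- r) e^[ a t]) ^ˢ i) l
        ≈⟨ rexp-^ (- r) a i l ⟩
      (((- r) ^ i) e^[ i · a t]) l
        ≈⟨ const-⊠ ((- r) ^ i) exp[ i · a t] l ⟩
      (- r) ^ i * (1/ l ! * (i · a) ^ l)
        ≈⟨ *-cong ([-x]^n≈[-1]^n*x^n r i)
             (*-congˡ (trans (^-congˡ l (n·x≈⟨n⟩*x i a)) (^-distrib-* ⟨ i ⟩ a l))) ⟩
      (- 1#) ^ i * r ^ i * (1/ l ! * (⟨ i ⟩ ^ l * a ^ l))
        ≈⟨ solve 5 (λ e s h j b → (e ⊕ s) ⊕ (h ⊕ (j ⊕ b)) ⊜ (b ⊕ h) ⊕ ((e ⊕ j) ⊕ s)) refl _ _ _ _ _ ⟩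
      a ^ l * 1/ l ! * ((- 1#) ^ i * ⟨ i ⟩ ^ l * r ^ i)
        ∎)

  -- The series D_a, the symmetric form and the comparison of coefficients.

  module _ (q : Carrier) (hq : ∣ q - 1# ∣<p^- 1/[p-1]) where

    D : ℕ → Series
    D a = (q ^ a) e^[ ⟨ a ⟩ t] ⊞ const 1#

    -- Long division needs a constant term apart from zero: `q ^ a` stays in the disc around 1, so
    -- `q ^ a + 1` is close to 2, a unit because `p` is odd.
    D⁻¹ : ℕ → Series
    D⁻¹ a = quotient 1# ((q , hq) ^ᴰ a) ⟨ a ⟩

    D-inverse : ∀ a → D a ⊠ D⁻¹ a ≋ const 1#
    D-inverse a = S.trans (⊠-comm (D a) (D⁻¹ a)) (quotient-⊠ 1# ((q , hq) ^ᴰ a) ⟨ a ⟩)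

    quotient≋D⁻¹ : ∀ b a → quotient b ((q , hq) ^ᴰ a) ⟨ a ⟩ ≋ const b ⊠ D⁻¹ a
    quotient≋D⁻¹ b a = SProps.x*y≈z⇒x≈z*y⁻¹
      {quotient b ((q , hq) ^ᴰ a) ⟨ a ⟩} {D a} {D⁻¹ a} {const b}
      (quotient-⊠ b ((q , hq) ^ᴰ a) ⟨ a ⟩) (D-inverse a)

    T-series≋D⁻¹ : ∀ a w W → Odd w → a ℕ.* w ≡ W → T-series (q ^ a) (w ∸ 1) ⟨ a ⟩ ≋ D W ⊠ D⁻¹ a
    -- Oddness excludes `w = 0`, so `w ∸ 1` is a true predecessor and the power sum has exactly `w`
    -- terms.
    T-series≋D⁻¹ a w@(suc w-1) W w-odd ≡.refl = SProps.x*y≈z⇒x≈z*y⁻¹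
      {T-series (q ^ a) w-1 ⟨ a ⟩} {D a} {D⁻¹ a} {D W}
      (S.trans (⊠-cong {g = D a} (T-series-geometricSum (q ^ a) w-1 ⟨ a ⟩) S.refl)
      (S.trans (SProps.alternatingSum-* w ((q ^ a) e^[ ⟨ a ⟩ t]) w-odd)
      (S.+-congʳ (S.trans (rexp-^ (q ^ a) ⟨ a ⟩ w) (rexp-cong (^-assocʳ q a w) w·⟨a⟩≈⟨aw⟩)))))
      (D-inverse a)
      where
      w·⟨a⟩≈⟨aw⟩ : w · ⟨ a ⟩ ≈ ⟨ a ℕ.* w ⟩
      w·⟨a⟩≈⟨aw⟩ = trans (n·x≈⟨n⟩*x w ⟨ a ⟩) (trans (*-comm _ _) (sym (⟨⟩-* a w)))

    symmetricForm : ℕ → Carrier → ℕ → ℕ → ℕ → Series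
    symmetricForm W y a b c =
      const ⟨ 2 ⟩ ⊠ exp[ ⟨ W ⟩ * y t] ⊠ (D W ⊠ D W) ⊠ (D⁻¹ a ⊠ D⁻¹ b ⊠ D⁻¹ c)

    -- Consecutive sums of the theorem differ by a cyclic shift of the weights, so this one
    -- permutation suffices.
    symmetricForm-rotate : ∀ W y a b c → symmetricForm W y a b c ≋ symmetricForm W y b c a
    symmetricForm-rotate W y a b c = ⊠-cong {const ⟨ 2 ⟩ ⊠ exp[ ⟨ W ⟩ * y t] ⊠ (D W ⊠ D W)} S.refl
      (S.trans (⊠-assoc (D⁻¹ a) (D⁻¹ b) (D⁻¹ c)) (⊠-comm (D⁻¹ a) (D⁻¹ b ⊠ D⁻¹ c)))

    -- Σ_k E_{k,q^a}(x) (at)^k / k!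
    E-series : ℕ → Carrier → Series
    E-series a x = scale ⟨ a ⟩ (divide (const ⟨ 2 ⟩) (denominator (q ^ a)) (denominator#0 ((q , hq) ^ᴰ a)) ⊠ exp[ x t])

    -- The Euler factor becomes 2 e^{Wyt} / D_a, since a w₁ = W. The power sums have `w₂` and `w₃`
    -- terms, whence the oddness of these two, and become D_W / D_b and D_W / D_c.
    product≋symmetricForm : ∀ w₁ w₂ w₃ W a b c y → Odd w₂ → Odd w₃ →
      a ℕ.* w₁ ≡ W → b ℕ.* w₂ ≡ W → c ℕ.* w₃ ≡ W →
      E-series a (⟨ w₁ ⟩ * y) ⊠ (T-series (q ^ b) (w₂ ∸ 1) ⟨ b ⟩ ⊠ T-series (q ^ c) (w₃ ∸ 1) ⟨ c ⟩)
        ≋ symmetricForm W y a b c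
    product≋symmetricForm w₁ w₂ w₃ W a b c y w₂-odd w₃-odd aw₁≡W bw₂≡W cw₃≡W = S.trans
      (⊠-cong {E-series a (⟨ w₁ ⟩ * y)} {const ⟨ 2 ⟩ ⊠ D⁻¹ a ⊠ exp[ ⟨ W ⟩ * y t]}
        (S.trans (scale-⊠ ⟨ a ⟩ (divide (const ⟨ 2 ⟩) (denominator (q ^ a)) (denominator#0 ((q , hq) ^ᴰ a))) exp[ ⟨ w₁ ⟩ * y t])
          (⊠-cong (quotient≋D⁻¹ ⟨ 2 ⟩ a) (S.trans (scale-exp ⟨ a ⟩ (⟨ w₁ ⟩ * y)) (exp-cong aw₁y≈Wy))))
        (⊠-cong (T-series≋D⁻¹ b w₂ W w₂-odd bw₂≡W) (T-series≋D⁻¹ c w₃ W w₃-odd cw₃≡W)))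
      (SProps.collect-quotients (const ⟨ 2 ⟩) exp[ ⟨ W ⟩ * y t] (D W) (D⁻¹ a) (D⁻¹ b) (D⁻¹ c))
      where
      aw₁y≈Wy : ⟨ a ⟩ * (⟨ w₁ ⟩ * y) ≈ ⟨ W ⟩ * y
      aw₁y≈Wy = trans (sym (*-assoc _ _ _)) (*-congʳ (trans (sym (⟨⟩-* a w₁)) (⟨⟩-cong aw₁≡W)))

    -- `a`, `b`, `c` stand for the pairwise products of the weights. Keeping them as variables lets
    -- all three sums be instances although the order of their factors differs.
    summand : (w₁ w₂ w₃ a b c : ℕ) → Carrier → (n k l m : ℕ) → Carrier
    summand w₁ w₂ w₃ a b c y n k l m = multinomial n k l m ·
      ( E k ((q , hq) ^ᴰ a) (⟨ w₁ ⟩ * y) * T l (q ^ b) (w₂ ∸ 1) * T m (q ^ c) (w₃ ∸ 1)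
      * ⟨ w₁ ⟩ ^ (l ℕ.+ m) * ⟨ w₂ ⟩ ^ (k ℕ.+ m) * ⟨ w₃ ⟩ ^ (k ℕ.+ l) )

    -- The weights regroup as (w₂w₃)^k (w₁w₃)^l (w₁w₂)^m = a^k b^l c^m. These are the powers
    -- produced by rescaling `t` in the three generating functions, so the sum is n! times a
    -- coefficient of their product.
    sum≈symmetricForm : ∀ w₁ w₂ w₃ W a b c n y → Odd w₂ → Odd w₃ →
      a ≡ w₂ ℕ.* w₃ → b ≡ w₁ ℕ.* w₃ → c ≡ w₁ ℕ.* w₂ → w₁ ℕ.* w₂ ℕ.* w₃ ≡ W →
      ∑₃ n (summand w₁ w₂ w₃ a b c y n)
      ≈ ⟨ n ! ⟩ * symmetricForm W y a b c n
    sum≈symmetricForm w₁ w₂ w₃ W a b c n y w₂-odd w₃-odd a≡w₂w₃ b≡w₁w₃ c≡w₁w₂ w₁w₂w₃≡W = begin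
      ∑₃ n (summand w₁ w₂ w₃ a b c y n)
        -- Summing over `k` first and then over `l ≤ n ∸ k` is the right-nested product
        -- `e ⊠ (f ⊠ g)`.
        ≈⟨ ∑≤-cong n inner ⟩
      ∑≤ n (λ k → ⟨ n ! ⟩ * (e k * (f ⊠ g) (n ∸ k)))
        ≈⟨ *-distribˡ-∑≤ n ⟨ n ! ⟩ (λ k → e k * (f ⊠ g) (n ∸ k)) ⟨
      ⟨ n ! ⟩ * (e ⊠ (f ⊠ g)) n
        ≈⟨ *-congˡ (product≋symmetricForm w₁ w₂ w₃ W a b c y w₂-odd w₃-odd aw₁≡W bw₂≡W cw₃≡W n) ⟩
      ⟨ n ! ⟩ * symmetricForm W y a b c n
        ∎
      where
      e = E-series a (⟨ w₁ ⟩ * y)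
      f = T-series (q ^ b) (w₂ ∸ 1) ⟨ b ⟩
      g = T-series (q ^ c) (w₃ ∸ 1) ⟨ c ⟩

      aw₁≡W : a ℕ.* w₁ ≡ W
      aw₁≡W = ≡.trans (≡.cong (ℕ._* w₁) a≡w₂w₃) (≡.trans (lemma w₁ w₂ w₃) w₁w₂w₃≡W)
        where
        lemma : ∀ x y z → y ℕ.* z ℕ.* x ≡ x ℕ.* y ℕ.* z
        lemma = solve-∀

      bw₂≡W : b ℕ.* w₂ ≡ W
      bw₂≡W = ≡.trans (≡.cong (ℕ._* w₂) b≡w₁w₃) (≡.trans (lemma w₁ w₂ w₃) w₁w₂w₃≡W)
        where
        lemma : ∀ x y z → x ℕ.* z ℕ.* y ≡ x ℕ.* y ℕ.* z
        lemma = solve-∀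

      cw₃≡W : c ℕ.* w₃ ≡ W
      cw₃≡W = ≡.trans (≡.cong (ℕ._* w₃) c≡w₁w₂) w₁w₂w₃≡W

      power : ∀ {d} u v i → d ≡ u ℕ.* v → ⟨ d ⟩ ^ i ≈ ⟨ u ⟩ ^ i * ⟨ v ⟩ ^ i
      power u v i d≡uv = trans (^-congˡ i (trans (⟨⟩-cong d≡uv) (⟨⟩-* u v))) (^-distrib-* ⟨ u ⟩ ⟨ v ⟩ i)

      -- The Euler generating function before rescaling: by definition `E` contributes k! times
      -- `G k`, while `e k` is ⟨a⟩^k times `G k`.
      G : Series
      G = divide (const ⟨ 2 ⟩) (denominator (q ^ a)) (denominator#0 ((q , hq) ^ᴰ a)) ⊠ exp[ ⟨ w₁ ⟩ * y t]

      term : ∀ k l → k ℕ.≤ n → l ℕ.≤ n ∸ k → let m = n ∸ k ∸ l in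
        summand w₁ w₂ w₃ a b c y n k l m ≈ ⟨ n ! ⟩ * e k * (f l * g m)
      term k l k≤n l≤n∸k = begin
        multinomial n k l m ·
          ( (k !) · G k * Tₗ * Tₘ * ⟨ w₁ ⟩ ^ (l ℕ.+ m) * ⟨ w₂ ⟩ ^ (k ℕ.+ m) * ⟨ w₃ ⟩ ^ (k ℕ.+ l) )
          ≈⟨ n·x≈⟨n⟩*x (multinomial n k l m) _ ⟩
        ⟨ multinomial n k l m ⟩ *
          ( (k !) · G k * Tₗ * Tₘ * ⟨ w₁ ⟩ ^ (l ℕ.+ m) * ⟨ w₂ ⟩ ^ (k ℕ.+ m) * ⟨ w₃ ⟩ ^ (k ℕ.+ l) )
          ≈⟨ *-cong (⟨multinomial⟩ n k l k≤n l≤n∸k)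
               (*-cong (*-cong (*-cong (*-congʳ (*-congʳ (n·x≈⟨n⟩*x (k !) (G k))))
                 (^-homo-* ⟨ w₁ ⟩ l m)) (^-homo-* ⟨ w₂ ⟩ k m)) (^-homo-* ⟨ w₃ ⟩ k l)) ⟩
        ⟨ n ! ⟩ * (1/ k ! * 1/ l ! * 1/ m !) *
          ( ⟨ k ! ⟩ * G k * Tₗ * Tₘ * (⟨ w₁ ⟩ ^ l * ⟨ w₁ ⟩ ^ m)
          * (⟨ w₂ ⟩ ^ k * ⟨ w₂ ⟩ ^ m) * (⟨ w₃ ⟩ ^ k * ⟨ w₃ ⟩ ^ l) )
          -- The k! inside `E` is placed next to 1/k! to cancel, while 1/l! and 1/m! stay with the
          -- power sums as in `T-series`. Each power of a weight joins the factor that has its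
          -- exponent.
          ≈⟨ solve 14 (λ N ik il im k! Gk Tl Tm u₁ v₁ u₂ v₂ u₃ v₃ →
               (N ⊕ ((ik ⊕ il) ⊕ im)) ⊕ ((((((k! ⊕ Gk) ⊕ Tl) ⊕ Tm) ⊕ (u₁ ⊕ v₁)) ⊕ (u₂ ⊕ v₂)) ⊕ (u₃ ⊕ v₃))
               ⊜ (k! ⊕ ik) ⊕ ((N ⊕ ((u₂ ⊕ u₃) ⊕ Gk)) ⊕ (((u₁ ⊕ v₃) ⊕ (il ⊕ Tl)) ⊕ ((v₁ ⊕ v₂) ⊕ (im ⊕ Tm)))))
               refl _ _ _ _ _ _ _ _ _ _ _ _ _ _ ⟩
        ⟨ k ! ⟩ * 1/ k ! * (⟨ n ! ⟩ * (⟨ w₂ ⟩ ^ k * ⟨ w₃ ⟩ ^ k * G k) *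
          (⟨ w₁ ⟩ ^ l * ⟨ w₃ ⟩ ^ l * (1/ l ! * Tₗ) * (⟨ w₁ ⟩ ^ m * ⟨ w₂ ⟩ ^ m * (1/ m ! * Tₘ))))
          ≈⟨ trans (*-congʳ (n!*1/n!≈1 k)) (*-identityˡ _) ⟩
        ⟨ n ! ⟩ * (⟨ w₂ ⟩ ^ k * ⟨ w₃ ⟩ ^ k * G k) *
          (⟨ w₁ ⟩ ^ l * ⟨ w₃ ⟩ ^ l * (1/ l ! * Tₗ) * (⟨ w₁ ⟩ ^ m * ⟨ w₂ ⟩ ^ m * (1/ m ! * Tₘ)))
          ≈⟨ *-cong (*-congˡ (*-congʳ (power w₂ w₃ k a≡w₂w₃)))
               (*-cong (*-congʳ (power w₁ w₃ l b≡w₁w₃)) (*-congʳ (power w₁ w₂ m c≡w₁w₂))) ⟨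
        ⟨ n ! ⟩ * e k * (f l * g m)
          ∎
        where
        m  = n ∸ k ∸ l
        Tₗ = T l (q ^ b) (w₂ ∸ 1)
        Tₘ = T m (q ^ c) (w₃ ∸ 1)

      inner : ∀ k → k ℕ.≤ n →
        ∑≤ (n ∸ k) (λ l → summand w₁ w₂ w₃ a b c y n k l (n ∸ k ∸ l)) ≈ ⟨ n ! ⟩ * (e k * (f ⊠ g) (n ∸ k))
      inner k k≤n = trans (∑≤-cong (n ∸ k) (λ l l≤n∸k → term k l k≤n l≤n∸k))
        (trans (sym (*-distribˡ-∑≤ (n ∸ k) (⟨ n ! ⟩ * e k) (λ l → f l * g (n ∸ k ∸ l)))) (*-assoc _ _ _))

-- Equality of the three sums by cyclic symmetry.

theorem4p8 : ∀ {c ℓ₁ ℓ₂ : Level} (p : ℕ) (p-prime : Prime p) (p-odd : Odd p) (K : ℂₚ p c ℓ₁ ℓ₂) →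
  let open Euler p p-prime p-odd K in
  (q : Carrier) (hq : ∣ q - 1# ∣<p^- 1/[p-1]) →
  (w₁ w₂ w₃ : ℕ) → Odd w₁ → Odd w₂ → Odd w₃ → (n : ℕ) (y₁ : ℤₚ) →
  let y  = fromℤₚ y₁
      S₁ = ∑₃ n λ k l m → multinomial n k l m ·
             ( E k ((q , hq) ^ᴰ (w₂ ℕ.* w₃)) (⟨ w₁ ⟩ * y)
             * T l (q ^ (w₁ ℕ.* w₃)) (w₂ ∸ 1)
             * T m (q ^ (w₁ ℕ.* w₂)) (w₃ ∸ 1)
             * ⟨ w₁ ⟩ ^ (l ℕ.+ m) * ⟨ w₂ ⟩ ^ (k ℕ.+ m) * ⟨ w₃ ⟩ ^ (k ℕ.+ l) )
      S₂ = ∑₃ n λ k l m → multinomial n k l m ·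
             ( E k ((q , hq) ^ᴰ (w₁ ℕ.* w₃)) (⟨ w₂ ⟩ * y)
             * T l (q ^ (w₁ ℕ.* w₂)) (w₃ ∸ 1)
             * T m (q ^ (w₂ ℕ.* w₃)) (w₁ ∸ 1)
             * ⟨ w₂ ⟩ ^ (l ℕ.+ m) * ⟨ w₃ ⟩ ^ (k ℕ.+ m) * ⟨ w₁ ⟩ ^ (k ℕ.+ l) )
      S₃ = ∑₃ n λ k l m → multinomial n k l m ·
             ( E k ((q , hq) ^ᴰ (w₁ ℕ.* w₂)) (⟨ w₃ ⟩ * y)
             * T l (q ^ (w₂ ℕ.* w₃)) (w₁ ∸ 1)
             * T m (q ^ (w₁ ℕ.* w₃)) (w₂ ∸ 1)
             * ⟨ w₃ ⟩ ^ (l ℕ.+ m) * ⟨ w₁ ⟩ ^ (k ℕ.+ m) * ⟨ w₂ ⟩ ^ (k ℕ.+ l) )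
  in S₁ ≈ S₂ × S₂ ≈ S₃
theorem4p8 p p-prime p-odd K q hq w₁ w₂ w₃ w₁-odd w₂-odd w₃-odd n y₁ =
    trans S₁≈ (trans (*-congˡ (symmetricForm-rotate q hq W y w₂w₃ w₁w₃ w₁w₂ n)) (sym S₂≈))
  , trans S₂≈ (trans (*-congˡ (symmetricForm-rotate q hq W y w₁w₃ w₁w₂ w₂w₃ n)) (sym S₃≈))
  where
  open Euler p p-prime p-odd K
  open EulerProperties p p-prime p-odd K
  y = fromℤₚ y₁
  W = w₁ ℕ.* w₂ ℕ.* w₃
  w₂w₃ = w₂ ℕ.* w₃
  w₁w₃ = w₁ ℕ.* w₃
  w₁w₂ = w₁ ℕ.* w₂

  lemma₂ : ∀ x y z → y ℕ.* z ℕ.* x ≡ x ℕ.* y ℕ.* z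
  lemma₂ = solve-∀

  lemma₃ : ∀ x y z → z ℕ.* x ℕ.* y ≡ x ℕ.* y ℕ.* z
  lemma₃ = solve-∀

  S₁≈ = sum≈symmetricForm q hq w₁ w₂ w₃ W w₂w₃ w₁w₃ w₁w₂ n y w₂-odd w₃-odd ≡.refl ≡.refl ≡.refl ≡.refl
  -- At the shifted triple (w₂, w₃, w₁), commutativity reconciles the order of factors in the
  -- statement with the one that the shift produces; `W` stays the same.
  S₂≈ = sum≈symmetricForm q hq w₂ w₃ w₁ W w₁w₃ w₁w₂ w₂w₃ n y w₃-odd w₁-odd
    (ℕ.*-comm w₁ w₃) (ℕ.*-comm w₁ w₂) ≡.refl (lemma₂ w₁ w₂ w₃)
  S₃≈ = sum≈symmetricForm q hq w₃ w₁ w₂ W w₁w₂ w₂w₃ w₁w₃ n y w₁-odd w₂-odd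
    ≡.refl (ℕ.*-comm w₂ w₃) (ℕ.*-comm w₁ w₃) (lemma₃ w₁ w₂ w₃)
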